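{- For each odd $n\ge 1$, the number of cycles of length $8$ in the regular locally transitive tournament $RLT_n$ is $$c_{8}(RLT_{n})=\frac{(n+1)n(n-1)(n-3)(n-5)(n-7)(83n^{2}-575n+510)}{161280}.$$
   Context: For odd $n$, $RLT_n$ is the tournament on vertex set $\mathbb{Z}_n=\{0,\dots,n-1\}$ in which $(i,j)$ is an arc if and only if $j-i \pmod n$ lies in $\{1,\dots,\frac{n-1}{2}\}$. (Equivalently, it is the unique regular tournament of order $n$ in which the out-set and in-set of every vertex induce transitive tournaments.) A cycle of length $m$ is a directed cycle through $m$ distinct vertices, counted as a subgraph (not with a distinguished starting point); $c_m(T)$ denotes the number of such cycles in $T$. -}

module Defs where

open import Data.Nat using (ℕ; zero; suc; _+_; _*_; _∸_; _/_; _%_; _≤ᵇ_; _≡ᵇ_)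
open import Data.Bool using (Bool; true; false; _∧_; not)
open import Data.Fin using (Fin; toℕ)
open import Data.List using (List; []; _∷_; [_]; map; concatMap; filterᵇ; length)
open import Data.List.Base using (all)
open import Data.List.Base using (allFin)

diffMod : (n : ℕ) → Fin n → Fin n → ℕ
diffMod (suc n) i j = (toℕ j + suc n ∸ toℕ i) % suc n
diffMod zero () j

arcᵇ : (n : ℕ) → Fin n → Fin n → Bool
arcᵇ n i j = (1 ≤ᵇ diffMod n i j) ∧ (diffMod n i j ≤ᵇ ((n ∸ 1) / 2))

allSeqs : (n m : ℕ) → List (List (Fin n))
allSeqs n zero = [ [] ]
allSeqs n (suc m) = concatMap (λ v → map (_∷ v) (allFin n)) (allSeqs n m)

distinctᵇ : {n : ℕ} → List (Fin n) → Bool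
distinctᵇ [] = true
distinctᵇ (x ∷ xs) = all (λ y → not (toℕ x ≡ᵇ toℕ y)) xs ∧ distinctᵇ xs

walkToᵇ : (n : ℕ) → Fin n → List (Fin n) → Bool
walkToᵇ n first [] = false
walkToᵇ n first (x ∷ []) = arcᵇ n x first
walkToᵇ n first (x ∷ y ∷ ys) = arcᵇ n x y ∧ walkToᵇ n first (y ∷ ys)

closedWalkᵇ : (n : ℕ) → List (Fin n) → Bool
closedWalkᵇ n [] = false
closedWalkᵇ n (x ∷ xs) = walkToᵇ n x (x ∷ xs)

cyclicSeqCount : (m n : ℕ) → ℕ
cyclicSeqCount m n =
  length (filterᵇ (λ s → distinctᵇ s ∧ closedWalkᵇ n s) (allSeqs n m))

-- c_m(RLT_n): number of m-cycles as subgraphs; each such cycle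
-- (m ≥ 1) corresponds to exactly m rooted cyclic sequences.
cRLT : (m n : ℕ) → ℕ
cRLT m n = cyclicSeqCount m n / suc (m ∸ 1)

module Submission where

{-
Doubling the vertices modulo n = 2k+1 turns RLT_n into the tournament on {0, …, n-1} in which, for a < b, there is
an arc from a to b exactly when a and b have the same parity. Choose the vertices of a rooted 8-cycle in decreasing
order. What the vertices already chosen demand of the smaller ones depends only on their positions in the cycle and
their parities, so the number F n s of ways of completing a partial choice s with vertices below n satisfies a linear
recurrence over finitely many states s. For odd n it reads F (n+2) = F n + N (F n), with N nilpotent because it fills
slots. Hence k ↦ F (2k+1) s is a polynomial with forward differences Nʲ (F 1) s at k = 0, and Newton's forward
difference formula gives 8 c₈(RLT_{2k+1}) once these nine numbers are evaluated at the empty state.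
-}

open import Defs
open import Algebra.Bundles using (CommutativeMonoid)
open import Algebra.Properties.CommutativeSemigroup using (interchange; x∙yz≈y∙xz)
open import Data.Bool using (Bool; true; false; _∧_; not; _xor_; if_then_else_; T)
open import Data.Bool.ListAction using (all)
open import Data.Bool.Properties using (∧-zeroʳ; ∧-identityʳ; ∧-commutativeMonoid; T-≡; ¬-not)
open import Data.Fin using (Fin; toℕ)
open import Data.Fin.Properties using (toℕ<n)
open import Data.List using (List; []; _∷_; map; _++_; replicate;
  concatMap; downFrom; filterᵇ; length; catMaybes; allFin; tabulate)
open import Data.List.Properties using (map-++; map-∘; map-tabulate)
open import Data.List.Relation.Binary.Permutation.Propositional using (_↭_; ↭-refl; ↭-trans; ↭-sym; ↭⇒↭ₛ; prep; swap)
open import Data.List.Relation.Binary.Permutation.Propositional.Properties using (All-resp-↭)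
import Data.List.Relation.Binary.Permutation.Setoid.Properties as Permutationₛ
open import Data.List.Relation.Unary.All as All using (All; []; _∷_)
import Data.List.Relation.Unary.All.Properties as All
open import Data.List.Relation.Unary.AllPairs using ([]; _∷_)
open import Data.List.Relation.Unary.Unique.Propositional using (Unique)
open import Data.Maybe as Maybe using (Maybe; just; nothing)
import Data.Maybe.Relation.Unary.All as MAll
open import Data.Nat using (ℕ)
open import Data.Nat.Combinatorics using (_C_; nCk+nC[k+1]≡[n+1]C[k+1])
open import Function using (_∘_; id)
open import Function.Bundles using (Equivalence)
open import Relation.Binary.Definitions using (tri<; tri≈; tri>)
open import Relation.Binary.PropositionalEquality using (_≡_; _≢_; refl; sym; trans; cong; cong₂;
  subst; setoid; module ≡-Reasoning)
open import Relation.Nullary using (contradiction; yes; no)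

module Counting where

  open import Data.Nat using (zero; suc; _+_; _*_; _∸_; _/_; _%_; _<_; _≤_; _≡ᵇ_; _<ᵇ_; _≤ᵇ_; s≤s)
  open import Data.Nat.DivMod using ([m+n]%n≡m%n; m<n⇒m%n≡m; m*n/n≡m)
  open import Data.Nat.ListAction using (sum)
  open import Data.Nat.ListAction.Properties using (sum-++)
  open import Data.Nat.Properties

  -- Finite sums over lists and indicators of Booleans.

  private variable
    A B : Set

  +-swap : ∀ a b c → a + (b + c) ≡ b + (a + c)
  +-swap = x∙yz≈y∙xz +-commutativeSemigroup

  +-interchange : ∀ a b c d → (a + b) + (c + d) ≡ (a + c) + (b + d)
  +-interchange = interchange +-commutativeSemigroup

  ∧-swap : ∀ a b c → a ∧ (b ∧ c) ≡ b ∧ (a ∧ c)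
  ∧-swap = x∙yz≈y∙xz (CommutativeMonoid.commutativeSemigroup ∧-commutativeMonoid)

  ∑ : List A → (A → ℕ) → ℕ
  ∑ xs f = sum (map f xs)

  syntax ∑ xs (λ x → e) = ∑[ x ← xs ] e

  ∑-congᴬ : ∀ {f g : A → ℕ} {xs} → All (λ x → f x ≡ g x) xs → ∑ xs f ≡ ∑ xs g
  ∑-congᴬ []         = refl
  ∑-congᴬ (eq ∷ eqs) = cong₂ _+_ eq (∑-congᴬ eqs)

  ∑-cong : ∀ {f g : A → ℕ} → (∀ x → f x ≡ g x) → ∀ xs → ∑ xs f ≡ ∑ xs g
  ∑-cong eq xs = ∑-congᴬ (All.universal eq xs)

  ∑-map : ∀ (f : B → ℕ) (h : A → B) xs → ∑ (map h xs) f ≡ ∑ xs (f ∘ h)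
  ∑-map f h xs = cong sum (sym (map-∘ xs))

  ∑-++ : ∀ (f : A → ℕ) xs ys → ∑ (xs ++ ys) f ≡ ∑ xs f + ∑ ys f
  ∑-++ f xs ys = trans (cong sum (map-++ f xs ys)) (sum-++ (map f xs) (map f ys))

  ∑-concatMap : ∀ (f : B → ℕ) (h : A → List B) xs → ∑ (concatMap h xs) f ≡ ∑[ x ← xs ] ∑ (h x) f
  ∑-concatMap f h []       = refl
  ∑-concatMap f h (x ∷ xs) = trans (∑-++ f (h x) (concatMap h xs)) (cong (∑ (h x) f +_) (∑-concatMap f h xs))

  ∑-0 : ∀ (xs : List A) → ∑[ x ← xs ] 0 ≡ 0
  ∑-0 []       = refl
  ∑-0 (x ∷ xs) = ∑-0 xs

  ∑-+ : ∀ (f g : A → ℕ) xs → ∑[ x ← xs ] (f x + g x) ≡ ∑ xs f + ∑ xs g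
  ∑-+ f g []       = refl
  ∑-+ f g (x ∷ xs) = trans (cong (f x + g x +_) (∑-+ f g xs)) (+-interchange (f x) _ _ _)

  ∑-*ˡ : ∀ c (f : A → ℕ) xs → ∑[ x ← xs ] (c * f x) ≡ c * ∑ xs f
  ∑-*ˡ c f []       = sym (*-zeroʳ c)
  ∑-*ˡ c f (x ∷ xs) = trans (cong (c * f x +_) (∑-*ˡ c f xs)) (sym (*-distribˡ-+ c (f x) _))

  ∑-swap : ∀ (f : A → B → ℕ) xs ys → ∑[ x ← xs ] ∑[ y ← ys ] f x y ≡ ∑[ y ← ys ] ∑[ x ← xs ] f x y
  ∑-swap f []       ys = sym (∑-0 ys)
  ∑-swap f (x ∷ xs) ys = trans (cong (∑ ys (f x) +_) (∑-swap f xs ys)) (sym (∑-+ (f x) _ ys))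

  𝟙 : Bool → ℕ
  𝟙 b = if b then 1 else 0

  𝟙-∧ : ∀ a b → 𝟙 (a ∧ b) ≡ 𝟙 a * 𝟙 b
  𝟙-∧ true  b = sym (+-identityʳ (𝟙 b))
  𝟙-∧ false b = refl

  length-filterᵇ : ∀ (P : A → Bool) xs → length (filterᵇ P xs) ≡ ∑ xs (𝟙 ∘ P)
  length-filterᵇ P []       = refl
  length-filterᵇ P (x ∷ xs) with P x
  ... | true  = cong suc (length-filterᵇ P xs)
  ... | false = length-filterᵇ P xs

  -- Sums over the fillings of a partial sequence.

  -- Entries of `L` may be repeated; excluding repetitions is left to the summand, which will vanish
  -- on them.
  fillSum : List ℕ → List (Maybe ℕ) → (List ℕ → ℕ) → ℕ
  fillSum L []             h = h []
  fillSum L (just a ∷ st)  h = fillSum L st (h ∘ (a ∷_))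
  fillSum L (nothing ∷ st) h = ∑[ y ← L ] fillSum L st (h ∘ (y ∷_))

  fresh : ℕ → List ℕ → Bool
  fresh x = all (λ y → not (x ≡ᵇ y))

  distinct : List ℕ → Bool
  distinct []      = true
  distinct (x ∷ v) = fresh x v ∧ distinct v

  ≡ᵇ-refl : ∀ n → (n ≡ᵇ n) ≡ true
  ≡ᵇ-refl zero    = refl
  ≡ᵇ-refl (suc n) = ≡ᵇ-refl n

  ∧-falseʳ : ∀ a {b} → b ≡ false → a ∧ b ≡ false
  ∧-falseʳ a refl = ∧-zeroʳ a

  ¬fresh-self : ∀ x v → fresh x (x ∷ v) ≡ false
  ¬fresh-self x v rewrite ≡ᵇ-refl x = refl

  ¬fresh⇒¬distinct : ∀ x v → fresh x v ≡ false → distinct (x ∷ v) ≡ false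
  ¬fresh⇒¬distinct x v eq rewrite eq = refl

  fillSum-0 : ∀ L st {h} → (∀ v → h v ≡ 0) → fillSum L st h ≡ 0
  fillSum-0 L []             h≡0 = h≡0 []
  fillSum-0 L (just a ∷ st)  h≡0 = fillSum-0 L st (h≡0 ∘ (a ∷_))
  fillSum-0 L (nothing ∷ st) h≡0 =
    trans (∑-cong (λ y → fillSum-0 L st (h≡0 ∘ (y ∷_))) L) (∑-0 L)

  -- Used when `x` has just been prefixed: a filling that uses `x` again then has a repetition and
  -- contributes 0.
  fillSum-skip : ∀ x L st {h} → (∀ v → fresh x v ≡ false → h v ≡ 0) →
    fillSum (x ∷ L) st h ≡ fillSum L st h
  fillSum-skip x L []             van = refl
  fillSum-skip x L (just a ∷ st)  van =
    fillSum-skip x L st (λ v eq → van (a ∷ v) (∧-falseʳ (not (x ≡ᵇ a)) eq))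
  fillSum-skip x L (nothing ∷ st) van = cong₂ _+_
    (fillSum-0 (x ∷ L) st (λ v → van (x ∷ v) (¬fresh-self x v)))
    (∑-cong (λ y → fillSum-skip x L st (λ v eq → van (y ∷ v) (∧-falseʳ (not (x ≡ᵇ y)) eq))) L)

  occupy : A → List (Maybe A) → List (List (Maybe A))
  occupy x []             = []
  occupy x (just a ∷ st)  = map (just a ∷_) (occupy x st)
  occupy x (nothing ∷ st) = (just x ∷ st) ∷ map (nothing ∷_) (occupy x st)

  -- Sequences with a repeated entry contribute nothing, so x is used for at most one empty slot.
  fillSum-peel : ∀ x L st {h} → (∀ v → distinct v ≡ false → h v ≡ 0) →
    fillSum (x ∷ L) st h ≡ fillSum L st h + ∑[ s ← occupy x st ] fillSum L s h
  fillSum-peel x L []             {h} van = sym (+-identityʳ (h []))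
  fillSum-peel x L (just a ∷ st)  {h} van = trans
    (fillSum-peel x L st (λ v eq → van (a ∷ v) (∧-falseʳ (fresh a v) eq)))
    (cong (fillSum L st (h ∘ (a ∷_)) +_) (sym (∑-map (λ s → fillSum L s h) _ (occupy x st))))
  fillSum-peel x L (nothing ∷ st) {h} van = begin
    fillSum (x ∷ L) st (h ∘ (x ∷_)) + ∑[ y ← L ] fillSum (x ∷ L) st (h ∘ (y ∷_))
      ≡⟨ cong₂ _+_ (fillSum-skip x L st (λ v eq → van (x ∷ v) (¬fresh⇒¬distinct x v eq)))
                   (∑-cong (λ y → fillSum-peel x L st (λ v eq → van (y ∷ v) (∧-falseʳ (fresh y v) eq))) L) ⟩
    a + ∑[ y ← L ] (fillSum L st (h ∘ (y ∷_)) + ∑[ s ← occupy x st ] fillSum L s (h ∘ (y ∷_)))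
      ≡⟨ cong (a +_) (∑-+ _ _ L) ⟩
    a + (b + ∑[ y ← L ] ∑[ s ← occupy x st ] fillSum L s (h ∘ (y ∷_)))
      ≡⟨ cong (λ z → a + (b + z)) (∑-swap (λ y s → fillSum L s (h ∘ (y ∷_))) L (occupy x st)) ⟩
    a + (b + ∑[ s ← occupy x st ] fillSum L (nothing ∷ s) h)
      ≡⟨ +-swap a b _ ⟩
    b + (a + ∑[ s ← occupy x st ] fillSum L (nothing ∷ s) h)
      ≡⟨ cong (λ z → b + (a + z)) (∑-map (λ s → fillSum L s h) _ (occupy x st)) ⟨
    b + (a + ∑ (map (nothing ∷_) (occupy x st)) (λ s → fillSum L s h)) ∎
    where
    open ≡-Reasoning
    a = fillSum L st (h ∘ (x ∷_))
    b = fillSum L (nothing ∷ st) h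

  -- Up to order, placing `x` only adds it to the chosen vertices, so bounds and uniqueness pass to
  -- the new partial sequence by permutation invariance.
  occupy-↭ : ∀ (x : A) st → All (λ s → catMaybes s ↭ x ∷ catMaybes st) (occupy x st)
  occupy-↭ x []             = []
  occupy-↭ x (just a ∷ st)  = All.map⁺ (All.map (λ p → ↭-trans (prep a p) (swap a x ↭-refl)) (occupy-↭ x st))
  occupy-↭ x (nothing ∷ st) = ↭-refl ∷ All.map⁺ (occupy-↭ x st)

  Unique⇒distinct : ∀ {v} → Unique v → distinct v ≡ true
  Unique⇒distinct []             = refl
  Unique⇒distinct {x ∷ v} (x∉v ∷ u) = cong₂ _∧_ (go x∉v) (Unique⇒distinct u)
    where
    go : ∀ {v} → All (x ≢_) v → fresh x v ≡ true
    go []                 = refl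
    go {y ∷ v} (x≢y ∷ x∉v) = cong₂ (λ a b → not a ∧ b)
      (¬-not (λ eq → x≢y (≡ᵇ⇒≡ x y (Equivalence.from T-≡ eq)))) (go x∉v)


  -- The relabelled tournament and its partial cycles.

  odd : ℕ → Bool
  odd zero    = false
  odd (suc n) = not (odd n)

  -- RLT_n after the relabelling v ↦ 2v mod n: for a < b, the arc goes from a to b exactly when the parities agree.
  arc : ℕ → ℕ → Bool
  arc a b = if odd a xor odd b then b <ᵇ a else a <ᵇ b

  -- An empty endpoint imposes no condition, so on a partial cycle only the arcs with both ends
  -- chosen are tested.
  arcᴹ : Maybe ℕ → Maybe ℕ → Bool
  arcᴹ nothing  _        = true
  arcᴹ (just a) nothing  = true
  arcᴹ (just a) (just b) = arc a b

  -- `e` is the slot to which the walk finally returns, `a` the slot it has reached.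
  walk : Maybe ℕ → Maybe ℕ → List (Maybe ℕ) → Bool
  walk e a []       = arcᴹ a e
  walk e a (s ∷ st) = arcᴹ a s ∧ walk e s st

  closed : List (Maybe ℕ) → Bool
  closed []       = false
  closed (s ∷ st) = walk s s st

  -- A slot is either empty or filled by a vertex of the given parity; only its parity matters,
  -- as the filled vertices are larger than all the remaining ones.
  State : Set
  State = List (Maybe Bool)

  parities : List (Maybe ℕ) → State
  parities = map (Maybe.map odd)

  -- The new vertex is smaller than every chosen one. An arc into it therefore needs opposite
  -- parities, and an arc out of it (`leaves`) equal ones.
  enters : Maybe Bool → Bool → Bool
  enters nothing  p = true
  enters (just q) p = q xor p

  leaves : Bool → Maybe Bool → Bool
  leaves p nothing  = true
  leaves p (just q) = not (p xor q)

  next : A → List A → A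
  next e []      = e
  next e (s ∷ _) = s

  last : A → List A → A
  last a []       = a
  last a (s ∷ st) = last s st

  fits : Maybe Bool → Bool → Maybe Bool → State → List State
  fits a p b st = if enters a p ∧ leaves p b then (just p ∷ st) ∷ [] else []

  -- `e` is the slot that closes the cycle and `a` the one just before the list; after the last
  -- slot, `next e` wraps around to `e`.
  placeBetween : Bool → Maybe Bool → Maybe Bool → State → List State
  placeBetween p e a []             = []
  placeBetween p e a (just q ∷ st)  = map (just q ∷_) (placeBetween p e (just q) st)
  placeBetween p e a (nothing ∷ st) = fits a p (next e st) st ++ map (nothing ∷_) (placeBetween p e nothing st)

  -- A single slot cannot be filled, since a vertex does not dominate itself.
  place : Bool → State → List State
  place p []                      = []
  place p (just q ∷ st)           = map (just q ∷_) (placeBetween p (just q) (just q) st)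
  place p (nothing ∷ [])          = []
  place p (nothing ∷ st@(_ ∷ _)) =
    fits (last nothing st) p (next nothing st) st ++ map (nothing ∷_) (placeBetween p nothing nothing st)

  full : State → ℕ
  full []             = 1
  full (nothing ∷ st) = 0
  full (just _ ∷ st)  = full st

  -- The number of ways of filling the empty slots with vertices below the given bound, largest first.
  F : ℕ → State → ℕ
  F zero    st = full st
  F (suc n) st = F n st + ∑ (place (odd n) st) (F n)

  -- Factoring the arc conditions when a vertex is placed.

  T⇒≡true : ∀ {b} → T b → b ≡ true
  T⇒≡true = Equivalence.to T-≡

  <⇒<ᵇ≡true : ∀ {m n} → m < n → (m <ᵇ n) ≡ true
  <⇒<ᵇ≡true = T⇒≡true ∘ <⇒<ᵇ

  ≤⇒<ᵇ≡false : ∀ {m n} → n ≤ m → (m <ᵇ n) ≡ false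
  ≤⇒<ᵇ≡false {m} {n} n≤m = ¬-not (λ eq → <⇒≱ (<ᵇ⇒< m n (Equivalence.from T-≡ eq)) n≤m)

  arc-irrefl : ∀ x → arc x x ≡ false
  arc-irrefl x with odd x
  ... | true  = ≤⇒<ᵇ≡false (≤-refl {x})
  ... | false = ≤⇒<ᵇ≡false (≤-refl {x})

  arc-enters : ∀ {x} a → MAll.All (x <_) a → arcᴹ a (just x) ≡ enters (Maybe.map odd a) (odd x)
  arc-enters nothing  _             = refl
  arc-enters {x} (just a) (MAll.just x<a) with odd a xor odd x
  ... | true  = <⇒<ᵇ≡true x<a
  ... | false = ≤⇒<ᵇ≡false (<⇒≤ x<a)

  arc-leaves : ∀ {x} b → MAll.All (x <_) b → arcᴹ (just x) b ≡ leaves (odd x) (Maybe.map odd b)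
  arc-leaves nothing  _             = refl
  arc-leaves {x} (just b) (MAll.just x<b) with odd x xor odd b
  ... | true  = ≤⇒<ᵇ≡false (<⇒≤ x<b)
  ... | false = <⇒<ᵇ≡true x<b

  arcᴹ-nothingʳ : ∀ a → arcᴹ a nothing ≡ true
  arcᴹ-nothingʳ nothing  = refl
  arcᴹ-nothingʳ (just a) = refl

  -- Emptying the current slot drops exactly the arc that leaves it; this isolates the condition
  -- which filling a slot adds. `walk-last` does the same for the closing arc.
  walk-head : ∀ e a st → walk e a st ≡ arcᴹ a (next e st) ∧ walk e nothing st
  walk-head e a []       = sym (∧-identityʳ _)
  walk-head e a (s ∷ st) = refl

  walk-last : ∀ e a st → walk e a st ≡ arcᴹ (last a st) e ∧ walk nothing a st
  walk-last e a []       = sym (trans (cong (arcᴹ a e ∧_) (arcᴹ-nothingʳ a)) (∧-identityʳ _))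
  walk-last e a (s ∷ st) = trans (cong (arcᴹ a s ∧_) (walk-last e s st))
    (∧-swap (arcᴹ a s) (arcᴹ (last s st) e) (walk nothing s st))

  parities-next : ∀ e st → Maybe.map odd (next e st) ≡ next (Maybe.map odd e) (parities st)
  parities-next e []       = refl
  parities-next e (s ∷ st) = refl

  parities-last : ∀ a st → Maybe.map odd (last a st) ≡ last (Maybe.map odd a) (parities st)
  parities-last a []       = refl
  parities-last a (s ∷ st) = parities-last s st

  next-All : ∀ {P : A → Set} {e st} → P e → All P st → P (next e st)
  next-All pe []       = pe
  next-All pe (ps ∷ _) = ps

  last-All : ∀ {P : A → Set} {a st} → P a → All P st → P (last a st)
  last-All pa []         = pa
  last-All pa (ps ∷ pst) = last-All ps pst

  All-catMaybes⁻ : ∀ {P : A → Set} st → All P (catMaybes st) → All (MAll.All P) st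
  All-catMaybes⁻ []             _          = []
  All-catMaybes⁻ (just a ∷ st)  (pa ∷ pst) = MAll.just pa ∷ All-catMaybes⁻ st pst
  All-catMaybes⁻ (nothing ∷ st) pst        = MAll.nothing ∷ All-catMaybes⁻ st pst

  ∑-fits : ∀ h a p b st → ∑ (fits a p b st) h ≡ 𝟙 (enters a p ∧ leaves p b) * h (just p ∷ st)
  ∑-fits h a p b st with enters a p ∧ leaves p b
  ... | true  = refl
  ... | false = refl

  private
    Above : ℕ → Maybe ℕ → Set
    Above x = MAll.All (x <_)

  -- Since `x` lies below `a` and `b`, its two arcs depend only on parities, so they move from the
  -- weight into the choice of successor states.
  fits-weight : ∀ h x a b st w → Above x a → Above x b →
    𝟙 (arcᴹ a (just x) ∧ (arcᴹ (just x) b ∧ w)) * h (just (odd x) ∷ st)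
    ≡ 𝟙 w * ∑ (fits (Maybe.map odd a) (odd x) (Maybe.map odd b) st) h
  fits-weight h x a b st w x<a x<b
    rewrite arc-enters a x<a | arc-leaves b x<b
          | ∑-fits h (Maybe.map odd a) (odd x) (Maybe.map odd b) st
    with enters (Maybe.map odd a) (odd x) | leaves (odd x) (Maybe.map odd b) | w
  ... | true  | true  | true  = sym (+-identityʳ _)
  ... | true  | true  | false = refl
  ... | true  | false | true  = refl
  ... | true  | false | false = refl
  ... | false | _     | true  = refl
  ... | false | _     | false = refl

  -- The arcs between vertices already chosen are unaffected and factor out; the arcs at `x` are
  -- those tested by `placeBetween`. Keeping `h` arbitrary lets the recursion absorb each slot it
  -- passes.
  placeBetween-weight : ∀ h x e a st → Above x e → Above x a → All (Above x) st →
    ∑[ s ← occupy x st ] (𝟙 (walk e a s) * h (parities s))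
    ≡ 𝟙 (walk e a st) * ∑ (placeBetween (odd x) (Maybe.map odd e) (Maybe.map odd a) (parities st)) h
  placeBetween-weight h x e a []              x<e x<a []            = sym (*-zeroʳ (𝟙 (arcᴹ a e)))
  placeBetween-weight h x e a (just b ∷ st)   x<e x<a (x<b ∷ x<st) = begin
    ∑ (map (just b ∷_) (occupy x st)) (λ s → 𝟙 (walk e a s) * h (parities s))
      ≡⟨ ∑-map _ (just b ∷_) (occupy x st) ⟩
    ∑[ s ← occupy x st ] (𝟙 (α ∧ walk e (just b) s) * h′ (parities s))
      ≡⟨ ∑-cong (λ s → trans (cong (_* h′ (parities s)) (𝟙-∧ α _)) (*-assoc (𝟙 α) _ _)) (occupy x st) ⟩
    ∑[ s ← occupy x st ] (𝟙 α * (𝟙 (walk e (just b) s) * h′ (parities s)))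
      ≡⟨ ∑-*ˡ (𝟙 α) _ (occupy x st) ⟩
    𝟙 α * ∑[ s ← occupy x st ] (𝟙 (walk e (just b) s) * h′ (parities s))
      ≡⟨ cong (𝟙 α *_) (placeBetween-weight h′ x e (just b) st x<e x<b x<st) ⟩
    𝟙 α * (𝟙 (walk e (just b) st) * ∑ P h′)
      ≡⟨ *-assoc (𝟙 α) _ _ ⟨
    𝟙 α * 𝟙 (walk e (just b) st) * ∑ P h′
      ≡⟨ cong₂ _*_ (𝟙-∧ α _) (∑-map h (just (odd b) ∷_) P) ⟨
    𝟙 (α ∧ walk e (just b) st) * ∑ (map (just (odd b) ∷_) P) h ∎
    where
    open ≡-Reasoning
    α = arcᴹ a (just b)
    h′ = h ∘ (just (odd b) ∷_)
    P = placeBetween (odd x) (Maybe.map odd e) (just (odd b)) (parities st)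
  placeBetween-weight h x e a (nothing ∷ st) x<e x<a (_ ∷ x<st) = begin
    𝟙 (arcᴹ a (just x) ∧ walk e (just x) st) * h (just (odd x) ∷ parities st)
      + ∑ (map (nothing ∷_) (occupy x st)) (λ s → 𝟙 (walk e a s) * h (parities s))
      ≡⟨ cong₂ _+_ first rest ⟩
    𝟙 w * ∑ f h + 𝟙 w * ∑ (map (nothing ∷_) P) h
      ≡⟨ *-distribˡ-+ (𝟙 w) _ _ ⟨
    𝟙 w * (∑ f h + ∑ (map (nothing ∷_) P) h)
      ≡⟨ cong₂ _*_ (cong (λ c → 𝟙 (c ∧ w)) (arcᴹ-nothingʳ a)) (∑-++ h f _) ⟨
    𝟙 (arcᴹ a nothing ∧ w) * ∑ (f ++ map (nothing ∷_) P) h ∎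
    where
    open ≡-Reasoning
    w = walk e nothing st
    h′ = h ∘ (nothing ∷_)
    f = fits (Maybe.map odd a) (odd x) (next (Maybe.map odd e) (parities st)) (parities st)
    P = placeBetween (odd x) (Maybe.map odd e) nothing (parities st)

    first : 𝟙 (arcᴹ a (just x) ∧ walk e (just x) st) * h (just (odd x) ∷ parities st) ≡ 𝟙 w * ∑ f h
    first rewrite walk-head e (just x) st | sym (parities-next e st) =
      fits-weight h x a (next e st) (parities st) w x<a (next-All x<e x<st)

    rest : ∑ (map (nothing ∷_) (occupy x st)) (λ s → 𝟙 (walk e a s) * h (parities s))
           ≡ 𝟙 w * ∑ (map (nothing ∷_) P) h
    rest = begin
      ∑ (map (nothing ∷_) (occupy x st)) (λ s → 𝟙 (walk e a s) * h (parities s))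
        ≡⟨ ∑-map _ (nothing ∷_) (occupy x st) ⟩
      ∑[ s ← occupy x st ] (𝟙 (arcᴹ a nothing ∧ walk e nothing s) * h′ (parities s))
        ≡⟨ ∑-cong (λ s → cong (λ c → 𝟙 (c ∧ walk e nothing s) * h′ (parities s)) (arcᴹ-nothingʳ a)) (occupy x st) ⟩
      ∑[ s ← occupy x st ] (𝟙 (walk e nothing s) * h′ (parities s))
        ≡⟨ placeBetween-weight h′ x e nothing st x<e MAll.nothing x<st ⟩
      𝟙 w * ∑ P h′
        ≡⟨ cong (𝟙 w *_) (∑-map h (nothing ∷_) P) ⟨
      𝟙 w * ∑ (map (nothing ∷_) P) h ∎

  -- The first slot is treated apart, because `closed` uses it both as the start and as the end of
  -- the walk.
  place-weight : ∀ h x st → All (Above x) st →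
    ∑[ s ← occupy x st ] (𝟙 (closed s) * h (parities s)) ≡ 𝟙 (closed st) * ∑ (place (odd x) (parities st)) h
  place-weight h x []              []           = refl
  place-weight h x (just b ∷ st)   (x<b ∷ x<st) = begin
    ∑ (map (just b ∷_) (occupy x st)) (λ s → 𝟙 (closed s) * h (parities s))
      ≡⟨ ∑-map _ (just b ∷_) (occupy x st) ⟩
    ∑[ s ← occupy x st ] (𝟙 (walk (just b) (just b) s) * h′ (parities s))
      ≡⟨ placeBetween-weight h′ x (just b) (just b) st x<b x<b x<st ⟩
    𝟙 (walk (just b) (just b) st) * ∑ P h′
      ≡⟨ cong (𝟙 (closed (just b ∷ st)) *_) (∑-map h (just (odd b) ∷_) P) ⟨
    𝟙 (walk (just b) (just b) st) * ∑ (map (just (odd b) ∷_) P) h ∎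
    where
    open ≡-Reasoning
    h′ = h ∘ (just (odd b) ∷_)
    P = placeBetween (odd x) (just (odd b)) (just (odd b)) (parities st)
  place-weight h x (nothing ∷ []) (_ ∷ []) rewrite arc-irrefl x = refl
  place-weight h x (nothing ∷ st@(t ∷ ts)) (_ ∷ x<st@(_ ∷ _)) = begin
    𝟙 (walk (just x) (just x) st) * h (just (odd x) ∷ parities st)
      + ∑ (map (nothing ∷_) (occupy x st)) (λ s → 𝟙 (closed s) * h (parities s))
      ≡⟨ cong₂ _+_ first rest ⟩
    𝟙 w * ∑ f h + 𝟙 w * ∑ (map (nothing ∷_) P) h
      ≡⟨ *-distribˡ-+ (𝟙 w) _ _ ⟨
    𝟙 w * (∑ f h + ∑ (map (nothing ∷_) P) h)
      ≡⟨ cong (𝟙 w *_) (∑-++ h f _) ⟨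
    𝟙 w * ∑ (f ++ map (nothing ∷_) P) h ∎
    where
    open ≡-Reasoning
    w = walk nothing nothing st
    h′ = h ∘ (nothing ∷_)
    f = fits (last nothing (parities st)) (odd x) (next nothing (parities st)) (parities st)
    P = placeBetween (odd x) nothing nothing (parities st)

    -- Filling the first slot adds two arcs, the closing one and the opening one; `w` collects all
    -- the others.
    walk-loop : walk (just x) (just x) st
                ≡ arcᴹ (last nothing st) (just x) ∧ (arcᴹ (just x) t ∧ w)
    walk-loop = trans (walk-last (just x) (just x) st) (cong (arcᴹ (last nothing st) (just x) ∧_) (walk-head nothing (just x) st))

    first : 𝟙 (walk (just x) (just x) st) * h (just (odd x) ∷ parities st) ≡ 𝟙 w * ∑ f h
    first rewrite walk-loop | sym (parities-last nothing st) =
      fits-weight h x (last nothing st) t (parities st) w (last-All MAll.nothing x<st) (next-All MAll.nothing x<st)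

    rest : ∑ (map (nothing ∷_) (occupy x st)) (λ s → 𝟙 (closed s) * h (parities s))
           ≡ 𝟙 w * ∑ (map (nothing ∷_) P) h
    rest = begin
      ∑ (map (nothing ∷_) (occupy x st)) (λ s → 𝟙 (closed s) * h (parities s))
        ≡⟨ ∑-map _ (nothing ∷_) (occupy x st) ⟩
      ∑[ s ← occupy x st ] (𝟙 (walk nothing nothing s) * h′ (parities s))
        ≡⟨ placeBetween-weight h′ x nothing nothing st MAll.nothing MAll.nothing x<st ⟩
      𝟙 w * ∑ P h′
        ≡⟨ cong (𝟙 w *_) (∑-map h (nothing ∷_) P) ⟨
      𝟙 w * ∑ (map (nothing ∷_) P) h ∎

  -- The recurrence for completing a partial cycle.

  cycleIndicator : List ℕ → ℕ
  cycleIndicator v = 𝟙 (distinct v) * 𝟙 (closed (map just v))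

  ¬distinct⇒0 : ∀ v → distinct v ≡ false → cycleIndicator v ≡ 0
  ¬distinct⇒0 v eq rewrite eq = refl

  fillSum-[] : ∀ st h → fillSum [] st h ≡ full (parities st) * h (catMaybes st)
  fillSum-[] []             h = sym (+-identityʳ (h []))
  fillSum-[] (just a ∷ st)  h = fillSum-[] st (h ∘ (a ∷_))
  fillSum-[] (nothing ∷ st) h = refl

  -- If a slot is empty both sides vanish; otherwise `catMaybes` followed by `map just` gives back
  -- `st`.
  full-weight : ∀ st (f : List (Maybe ℕ) → ℕ) →
    full (parities st) * f (map just (catMaybes st)) ≡ full (parities st) * f st
  full-weight []             f = refl
  full-weight (just a ∷ st)  f = full-weight st (f ∘ (just a ∷_))
  full-weight (nothing ∷ st) f = refl

  -- Induction on `n`: the largest available vertex is left out or fills exactly one slot. As all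
  -- chosen vertices are distinct and lie above the remaining ones, their parities and positions
  -- determine the number of completions.
  fillSum-F : ∀ n st → All (n ≤_) (catMaybes st) → Unique (catMaybes st) →
    fillSum (downFrom n) st cycleIndicator ≡ 𝟙 (closed st) * F n (parities st)
  fillSum-F zero st _ uniq = begin
    fillSum [] st cycleIndicator                                    ≡⟨ fillSum-[] st cycleIndicator ⟩
    full (parities st) * (𝟙 (distinct (catMaybes st)) * 𝟙 (closed (map just (catMaybes st))))
      ≡⟨ cong (λ c → full (parities st) * (𝟙 c * 𝟙 (closed (map just (catMaybes st))))) (Unique⇒distinct uniq) ⟩
    full (parities st) * (1 * 𝟙 (closed (map just (catMaybes st))))
      ≡⟨ full-weight st (λ s → 1 * 𝟙 (closed s)) ⟩
    full (parities st) * (1 * 𝟙 (closed st))                ≡⟨ cong (full (parities st) *_) (*-identityˡ _) ⟩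
    full (parities st) * 𝟙 (closed st)                      ≡⟨ *-comm (full (parities st)) _ ⟩
    𝟙 (closed st) * full (parities st) ∎
    where open ≡-Reasoning
  fillSum-F (suc n) st n<st uniq = begin
    fillSum (n ∷ downFrom n) st cycleIndicator
      ≡⟨ fillSum-peel n (downFrom n) st ¬distinct⇒0 ⟩
    fillSum (downFrom n) st cycleIndicator + ∑[ s ← occupy n st ] fillSum (downFrom n) s cycleIndicator
      ≡⟨ cong₂ _+_ (fillSum-F n st n≤st uniq) (∑-congᴬ (All.map (λ {s} → step {s}) (occupy-↭ n st))) ⟩
    𝟙 (closed st) * F n (parities st) + ∑[ s ← occupy n st ] (𝟙 (closed s) * F n (parities s))
      ≡⟨ cong (𝟙 (closed st) * F n (parities st) +_) (place-weight (F n) n st (All-catMaybes⁻ st n<st)) ⟩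
    𝟙 (closed st) * F n (parities st) + 𝟙 (closed st) * ∑ (place (odd n) (parities st)) (F n)
      ≡⟨ *-distribˡ-+ (𝟙 (closed st)) _ _ ⟨
    𝟙 (closed st) * F (suc n) (parities st) ∎
    where
    open ≡-Reasoning
    n≤st = All.map <⇒≤ n<st

    step : ∀ {s} → catMaybes s ↭ n ∷ catMaybes st →
           fillSum (downFrom n) s cycleIndicator ≡ 𝟙 (closed s) * F n (parities s)
    step {s} p = fillSum-F n s (All-resp-↭ (↭-sym p) (≤-refl ∷ n≤st))
      (Permutationₛ.Unique-resp-↭ (setoid ℕ) (↭⇒↭ₛ (↭-sym p)) (All.map <⇒≢ n<st ∷ uniq))

  -- Transport of the count along a relabelling.

  -- `∑-ρ` and `≡ᵇ-ρ` express, in the two forms used, that `ρ` is a bijection onto the numbers below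
  -- `n`.
  module Relabelling {n} (ρ : Fin n → ℕ)
    (∑-ρ : ∀ f → ∑ (allFin n) (f ∘ ρ) ≡ ∑ (downFrom n) f)
    (≡ᵇ-ρ : ∀ i j → (toℕ i ≡ᵇ toℕ j) ≡ (ρ i ≡ᵇ ρ j))
    (arc-ρ : ∀ i j → arcᵇ n i j ≡ arc (ρ i) (ρ j)) where

    open ≡-Reasoning

    allSeqs-fillSum : ∀ m h → ∑ (allSeqs n m) (h ∘ map ρ) ≡ fillSum (downFrom n) (replicate m nothing) h
    allSeqs-fillSum zero    h = +-identityʳ (h [])
    allSeqs-fillSum (suc m) h = begin
      ∑ (allSeqs n (suc m)) (h ∘ map ρ)
        ≡⟨ ∑-concatMap (h ∘ map ρ) (λ v → map (_∷ v) (allFin n)) (allSeqs n m) ⟩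
      ∑[ v ← allSeqs n m ] ∑ (map (_∷ v) (allFin n)) (h ∘ map ρ)
        ≡⟨ ∑-cong (λ v → trans (∑-map (h ∘ map ρ) (_∷ v) (allFin n)) (∑-ρ (λ y → h (y ∷ map ρ v)))) (allSeqs n m) ⟩
      ∑[ v ← allSeqs n m ] ∑[ y ← downFrom n ] h (y ∷ map ρ v)
        -- `allSeqs` chooses the tail before the head, `fillSum` the head before the tail.
        ≡⟨ ∑-swap (λ v y → h (y ∷ map ρ v)) (allSeqs n m) (downFrom n) ⟩
      ∑[ y ← downFrom n ] ∑[ v ← allSeqs n m ] h (y ∷ map ρ v)
        ≡⟨ ∑-cong (λ y → allSeqs-fillSum m (h ∘ (y ∷_))) (downFrom n) ⟩
      fillSum (downFrom n) (replicate (suc m) nothing) h ∎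

    fresh-ρ : ∀ x s → all (λ y → not (toℕ x ≡ᵇ toℕ y)) s ≡ fresh (ρ x) (map ρ s)
    fresh-ρ x []      = refl
    fresh-ρ x (y ∷ s) = cong₂ (λ a b → not a ∧ b) (≡ᵇ-ρ x y) (fresh-ρ x s)

    distinct-ρ : ∀ s → distinctᵇ s ≡ distinct (map ρ s)
    distinct-ρ []      = refl
    distinct-ρ (x ∷ s) = cong₂ _∧_ (fresh-ρ x s) (distinct-ρ s)

    walk-ρ : ∀ e x s → walkToᵇ n e (x ∷ s) ≡ walk (just (ρ e)) (just (ρ x)) (map just (map ρ s))
    walk-ρ e x []      = arc-ρ x e
    walk-ρ e x (y ∷ s) = cong₂ _∧_ (arc-ρ x y) (walk-ρ e y s)

    closed-ρ : ∀ s → closedWalkᵇ n s ≡ closed (map just (map ρ s))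
    closed-ρ []      = refl
    closed-ρ (x ∷ s) = walk-ρ x x s

    cyclicSeqCount-fillSum : ∀ m → cyclicSeqCount m n ≡ fillSum (downFrom n) (replicate m nothing) cycleIndicator
    cyclicSeqCount-fillSum m = begin
      cyclicSeqCount m n
        ≡⟨ length-filterᵇ _ (allSeqs n m) ⟩
      ∑[ s ← allSeqs n m ] 𝟙 (distinctᵇ s ∧ closedWalkᵇ n s)
        ≡⟨ ∑-cong (λ s → trans (𝟙-∧ (distinctᵇ s) _) (cong₂ (λ a b → 𝟙 a * 𝟙 b) (distinct-ρ s) (closed-ρ s))) (allSeqs n m) ⟩
      ∑ (allSeqs n m) (cycleIndicator ∘ map ρ)
        ≡⟨ allSeqs-fillSum m cycleIndicator ⟩
      fillSum (downFrom n) (replicate m nothing) cycleIndicator ∎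

  -- Doubling modulo 2k+1 as a permutation.

  ∑-downFrom-head : ∀ n (f : ℕ → ℕ) → ∑ (downFrom (suc n)) f ≡ f 0 + ∑ (downFrom n) (f ∘ suc)
  ∑-downFrom-head zero    f = refl
  ∑-downFrom-head (suc n) f = begin
    f (suc n) + ∑ (downFrom (suc n)) f               ≡⟨ cong (f (suc n) +_) (∑-downFrom-head n f) ⟩
    f (suc n) + (f 0 + ∑ (downFrom n) (f ∘ suc))     ≡⟨ +-swap (f (suc n)) (f 0) _ ⟩
    f 0 + (f (suc n) + ∑ (downFrom n) (f ∘ suc))     ∎
    where
    open ≡-Reasoning

  ∑-allFin : ∀ n (f : ℕ → ℕ) → ∑ (allFin n) (f ∘ toℕ) ≡ ∑ (downFrom n) f
  ∑-allFin zero    f = refl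
  ∑-allFin (suc n) f = begin
    f 0 + ∑ (tabulate {n = n} Fin.suc) (f ∘ toℕ)
      ≡⟨ cong (λ (xs : List (Fin (suc n))) → f 0 + ∑ xs (f ∘ toℕ)) (map-tabulate {n = n} id Fin.suc) ⟨
    f 0 + ∑ (map Fin.suc (allFin n)) (f ∘ toℕ)      ≡⟨ cong (f 0 +_) (∑-map (f ∘ toℕ) Fin.suc (allFin n)) ⟩
    f 0 + ∑ (allFin n) (f ∘ suc ∘ toℕ)              ≡⟨ cong (f 0 +_) (∑-allFin n (f ∘ suc)) ⟩
    f 0 + ∑ (downFrom n) (f ∘ suc)                  ≡⟨ ∑-downFrom-head n f ⟨
    ∑ (downFrom (suc n)) f                          ∎
    where open ≡-Reasoning

  ∑-downFrom-+ : ∀ b a (f : ℕ → ℕ) → ∑ (downFrom (b + a)) f ≡ ∑[ i ← downFrom b ] f (a + i) + ∑ (downFrom a) f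
  ∑-downFrom-+ zero    a f = refl
  ∑-downFrom-+ (suc b) a f = trans (cong₂ _+_ (cong f (+-comm b a)) (∑-downFrom-+ b a f)) (sym (+-assoc (f (a + b)) _ _))

  -- The two sums on the left run over the images under `double` of the upper and the lower half of
  -- the vertices.
  ∑-parity : ∀ k (f : ℕ → ℕ) →
    ∑[ i ← downFrom k ] f (suc (i + i)) + ∑[ i ← downFrom (suc k) ] f (i + i) ≡ ∑ (downFrom (suc (k + k))) f
  ∑-parity zero    f = refl
  ∑-parity (suc k) f rewrite +-suc k k =
    trans (+-swap (f (suc (k + k)) + ∑[ i ← downFrom k ] f (suc (i + i))) (f (suc (suc (k + k)))) _)
          (cong (f (suc (suc (k + k))) +_)
                (trans (+-assoc (f (suc (k + k))) _ _) (cong (f (suc (k + k)) +_) (∑-parity k f))))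

  -- 2v modulo 2k+1
  double : ℕ → ℕ → ℕ
  double k v = if v ≤ᵇ k then v + v else suc ((v ∸ suc k) + (v ∸ suc k))

  -- A view adapted to `double`: the lower half needs no reduction, and k+1+u is sent to 2u+1
  -- because 2(k+1+u) = (2k+1) + (2u+1).
  data Half (k : ℕ) : ℕ → Set where
    low  : ∀ {u} → u ≤ k → Half k u
    high : ∀ {u} → u < k → Half k (suc k + u)

  half : ∀ k v → v < suc (k + k) → Half k v
  half k v v<n with v ≤? k
  ... | yes v≤k = low v≤k
  ... | no  v≰k = subst (Half k) k<v (high (+-cancelˡ-< (suc k) _ _ (subst (_< suc (k + k)) (sym k<v) v<n)))
    where k<v = m+[n∸m]≡n (≰⇒> v≰k)

  ≤⇒≤ᵇ≡true : ∀ {m n} → m ≤ n → (m ≤ᵇ n) ≡ true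
  ≤⇒≤ᵇ≡true = T⇒≡true ∘ ≤⇒≤ᵇ

  <⇒≤ᵇ≡false : ∀ {m n} → n < m → (m ≤ᵇ n) ≡ false
  <⇒≤ᵇ≡false {suc m} {n} (s≤s n≤m) = ≤⇒<ᵇ≡false n≤m

  double-low : ∀ {k u} → u ≤ k → double k u ≡ u + u
  double-low u≤k rewrite ≤⇒≤ᵇ≡true u≤k = refl

  double-high : ∀ k u → double k (suc k + u) ≡ suc (u + u)
  double-high k u rewrite <⇒≤ᵇ≡false (m≤m+n (suc k) u) | m+n∸m≡n k u = refl

  ∑-double : ∀ k (f : ℕ → ℕ) → ∑ (downFrom (suc (k + k))) (f ∘ double k) ≡ ∑ (downFrom (suc (k + k))) f
  ∑-double k f = begin
    ∑ (downFrom (suc (k + k))) (f ∘ double k)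
      ≡⟨ cong (λ n → ∑ (downFrom n) (f ∘ double k)) (+-suc k k) ⟨
    ∑ (downFrom (k + suc k)) (f ∘ double k)
      ≡⟨ ∑-downFrom-+ k (suc k) (f ∘ double k) ⟩
    ∑[ i ← downFrom k ] f (double k (suc k + i)) + ∑ (downFrom (suc k)) (f ∘ double k)
      ≡⟨ cong₂ _+_ (∑-cong (λ i → cong f (double-high k i)) (downFrom k))
                   (∑-congᴬ (All.applyDownFrom⁺₁ id (suc k) (λ { (s≤s i≤k) → cong f (double-low i≤k) }))) ⟩
    ∑[ i ← downFrom k ] f (suc (i + i)) + ∑[ i ← downFrom (suc k) ] f (i + i)
      ≡⟨ ∑-parity k f ⟩
    ∑ (downFrom (suc (k + k))) f ∎
    where open ≡-Reasoning

  odd-double : ∀ u → odd (u + u) ≡ false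
  odd-double zero    = refl
  odd-double (suc u) rewrite +-suc u u | odd-double u = refl

  u+u-injective : ∀ {u v} → u + u ≡ v + v → u ≡ v
  u+u-injective {u} {v} eq with <-cmp u v
  ... | tri< u<v _ _ = contradiction eq (<⇒≢ (+-mono-< u<v u<v))
  ... | tri≈ _ u≡v _ = u≡v
  ... | tri> _ _ v<u = contradiction (sym eq) (<⇒≢ (+-mono-< v<u v<u))

  u+u≢1+v+v : ∀ u v → u + u ≢ suc (v + v)
  u+u≢1+v+v u v eq with trans (sym (odd-double u)) (trans (cong odd eq) (cong not (odd-double v)))
  ... | ()

  double-injective : ∀ {k u v} → Half k u → Half k v → double k u ≡ double k v → u ≡ v
  double-injective (low u≤k) (low v≤k) eq =
    u+u-injective (trans (sym (double-low u≤k)) (trans eq (double-low v≤k)))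
  double-injective {k} (low {u} u≤k) (high {v} _) eq =
    contradiction (trans (sym (double-low u≤k)) (trans eq (double-high k v))) (u+u≢1+v+v u v)
  double-injective {k} (high {u} _) (low {v} v≤k) eq =
    contradiction (trans (sym (double-low v≤k)) (trans (sym eq) (double-high k u))) (u+u≢1+v+v v u)
  double-injective {k} (high {u} _) (high {v} _) eq =
    cong (suc k +_) (u+u-injective (suc-injective (trans (sym (double-high k u)) (trans eq (double-high k v)))))

  ≡ᵇ-cong : ∀ {a b c d} → (a ≡ b → c ≡ d) → (c ≡ d → a ≡ b) → (a ≡ᵇ b) ≡ (c ≡ᵇ d)
  ≡ᵇ-cong {a} {b} {c} {d} f g with a ≡ᵇ b in p | c ≡ᵇ d in q
  ... | true  | true  = refl
  ... | false | false = refl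
  ... | true  | false = trans (sym (T⇒≡true (≡⇒≡ᵇ c d (f (≡ᵇ⇒≡ a b (Equivalence.from T-≡ p)))))) q
  ... | false | true  = trans (sym p) (T⇒≡true (≡⇒≡ᵇ a b (g (≡ᵇ⇒≡ c d (Equivalence.from T-≡ q)))))

  -- Arcs before and after doubling.

  -- The arc test of RLT_n for n = 2k+1 on natural numbers, with (n-1)/2 replaced by `k`.
  chord : ℕ → ℕ → ℕ → Bool
  chord k a b = (1 ≤ᵇ δ) ∧ (δ ≤ᵇ k)
    where δ = (b + suc (k + k) ∸ a) % suc (k + k)

  module _ {k a b : ℕ} where
    private
      n = suc (k + k)

    forward : a ≤ b → b < n → (b + n ∸ a) % n ≡ b ∸ a
    forward a≤b b<n = begin
      (b + n ∸ a) % n  ≡⟨ cong (_% n) (+-∸-comm n a≤b) ⟩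
      (b ∸ a + n) % n  ≡⟨ [m+n]%n≡m%n (b ∸ a) n ⟩
      (b ∸ a) % n      ≡⟨ m<n⇒m%n≡m (≤-<-trans (m∸n≤m b a) b<n) ⟩
      b ∸ a            ∎
      where open ≡-Reasoning

    backward : b < a → (b + n ∸ a) % n ≡ b + n ∸ a
    backward b<a = m<n⇒m%n≡m (m<n+o⇒m∸n<o (b + n) a (+-monoˡ-< n b<a))

    -- By `forward` and `backward` the residue is b - a or b + n - a; in this and the next three
    -- lemmas a gap of at most `k` gives an upward arc, a larger gap a downward one.
    chord-near : a < b → b < n → b ≤ a + k → chord k a b ≡ true
    chord-near a<b b<n b≤a+k rewrite forward (<⇒≤ a<b) b<n =
      cong₂ _∧_ (≤⇒≤ᵇ≡true (m<n⇒0<n∸m a<b)) (≤⇒≤ᵇ≡true (m≤n+o⇒m∸n≤o b a b≤a+k))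

    chord-far : a < b → b < n → a + k < b → chord k a b ≡ false
    chord-far a<b b<n a+k<b rewrite forward (<⇒≤ a<b) b<n =
      ∧-falseʳ (1 ≤ᵇ b ∸ a) (<⇒≤ᵇ≡false (m+n≤o⇒m≤o∸n (suc k) (subst (_≤ b) (cong suc (+-comm a k)) a+k<b)))

    chord-near-back : b < a → a ≤ b + k → chord k a b ≡ false
    chord-near-back b<a a≤b+k rewrite backward b<a =
      ∧-falseʳ (1 ≤ᵇ b + n ∸ a) (<⇒≤ᵇ≡false (m+n≤o⇒m≤o∸n (suc k) le))
      where
      le : suc k + a ≤ b + n
      le = begin
        suc k + a        ≤⟨ +-monoʳ-≤ (suc k) a≤b+k ⟩
        suc k + (b + k)  ≡⟨ +-swap (suc k) b k ⟩
        b + n            ∎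
        where
        open ≤-Reasoning

    chord-far-back : b + k < a → a < n → chord k a b ≡ true
    chord-far-back b+k<a a<n rewrite backward (≤-<-trans (m≤m+n b k) b+k<a) =
      cong₂ _∧_ (≤⇒≤ᵇ≡true (m<n⇒0<n∸m (<-≤-trans a<n (m≤n+m n b))))
                (≤⇒≤ᵇ≡true (m≤n+o⇒m∸n≤o (b + n) a le))
      where
      le : b + n ≤ a + k
      le = begin
        b + n            ≡⟨ +-suc b (k + k) ⟩
        suc (b + (k + k)) ≡⟨ cong suc (+-assoc b k k) ⟨
        suc (b + k) + k  ≤⟨ +-monoˡ-≤ k b+k<a ⟩
        a + k            ∎
        where open ≤-Reasoning

  chord-refl : ∀ k a → a < suc (k + k) → chord k a a ≡ false
  chord-refl k a a<n rewrite forward {k} {a} {a} ≤-refl a<n | n∸n≡0 a = refl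

  chord-same : ∀ {k} a b → a < suc (k + k) → b < suc (k + k) → b ≤ a + k → a ≤ b + k →
    chord k a b ≡ (a <ᵇ b)
  chord-same {k} a b a<n b<n b≤a+k a≤b+k with <-cmp a b
  ... | tri< a<b _ _ = trans (chord-near {k} a<b b<n b≤a+k) (sym (<⇒<ᵇ≡true a<b))
  ... | tri≈ _ refl _ = trans (chord-refl k a a<n) (sym (≤⇒<ᵇ≡false (≤-refl {a})))
  ... | tri> _ _ b<a = trans (chord-near-back {k} b<a a≤b+k) (sym (≤⇒<ᵇ≡false (<⇒≤ b<a)))

  <ᵇ-double : ∀ u v → (u + u <ᵇ v + v) ≡ (u <ᵇ v)
  <ᵇ-double u v with u <? v
  ... | yes u<v = trans (<⇒<ᵇ≡true (+-mono-< u<v u<v)) (sym (<⇒<ᵇ≡true u<v))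
  ... | no  u≮v = trans (≤⇒<ᵇ≡false (+-mono-≤ (≮⇒≥ u≮v) (≮⇒≥ u≮v))) (sym (≤⇒<ᵇ≡false (≮⇒≥ u≮v)))

  <ᵇ-+ˡ : ∀ k u v → (k + u <ᵇ k + v) ≡ (u <ᵇ v)
  <ᵇ-+ˡ zero    u v = refl
  <ᵇ-+ˡ (suc k) u v = <ᵇ-+ˡ k u v

  ≤k⇒<n : ∀ {k u} → u ≤ k → u < suc (k + k)
  ≤k⇒<n {k} u≤k = s≤s (≤-trans u≤k (m≤m+n k k))

  -- Vertices of one half are at distance at most `k`, so the arc points upward, and doubling keeps
  -- their order. From u in the lower to k+1+v in the upper half the gap is at most `k` exactly when
  -- v < u, that is, when 2v+1 < 2u.
  chord-double : ∀ {k a b} → Half k a → Half k b → chord k a b ≡ arc (double k a) (double k b)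
  chord-double {k} (low {u} u≤k) (low {v} v≤k)
    rewrite double-low u≤k | double-low v≤k | odd-double u | odd-double v =
    trans (chord-same u v (≤k⇒<n u≤k) (≤k⇒<n v≤k) (≤-trans v≤k (m≤n+m k u)) (≤-trans u≤k (m≤n+m k v)))
          (sym (<ᵇ-double u v))
  chord-double {k} (high {u} u<k) (high {v} v<k)
    rewrite double-high k u | double-high k v | odd-double u | odd-double v =
    trans (chord-same (suc k + u) (suc k + v) (+-monoʳ-< (suc k) u<k) (+-monoʳ-< (suc k) v<k) (le u v<k) (le v u<k))
          (trans (<ᵇ-+ˡ (suc k) u v) (sym (<ᵇ-double u v)))
    where
    le : ∀ u {v} → v < k → suc k + v ≤ suc k + u + k
    le u v<k = ≤-trans (+-monoʳ-≤ (suc k) (<⇒≤ v<k)) (+-monoˡ-≤ k (m≤m+n (suc k) u))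
  chord-double {k} (low {u} u≤k) (high {v} v<k)
    rewrite double-low u≤k | double-high k v | odd-double u | odd-double v with v <? u
  ... | yes v<u = trans (chord-near {k} u<b b<n (subst (suc k + v ≤_) (+-comm k u) (subst (_≤ k + u) (+-suc k v) (+-monoʳ-≤ k v<u))))
                        (sym (<⇒<ᵇ≡true (+-mono-≤-< v<u v<u)))
    where
    u<b = s≤s (≤-trans u≤k (m≤m+n k v))
    b<n = +-monoʳ-< (suc k) v<k
  ... | no v≮u = trans (chord-far {k} u<b b<n (s≤s (subst (u + k ≤_) (+-comm v k) (+-monoˡ-≤ k (≮⇒≥ v≮u)))))
                       (sym (≤⇒<ᵇ≡false (m≤n⇒m≤1+n (+-mono-≤ (≮⇒≥ v≮u) (≮⇒≥ v≮u)))))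
    where
    u<b = s≤s (≤-trans u≤k (m≤m+n k v))
    b<n = +-monoʳ-< (suc k) v<k
  chord-double {k} (high {u} u<k) (low {v} v≤k)
    rewrite double-low v≤k | double-high k u | odd-double u | odd-double v with v ≤? u
  ... | yes v≤u = trans (chord-far-back {k} (s≤s (subst (v + k ≤_) (+-comm u k) (+-monoˡ-≤ k v≤u))) (+-monoʳ-< (suc k) u<k))
                        (sym (<⇒<ᵇ≡true (s≤s (+-mono-≤ v≤u v≤u))))
  ... | no v≰u = trans (chord-near-back {k} (s≤s (≤-trans v≤k (m≤m+n k u)))
                          (subst (suc k + u ≤_) (+-comm k v) (subst (_≤ k + v) (+-suc k u) (+-monoʳ-≤ k (≰⇒> v≰u)))))
                       (sym (≤⇒<ᵇ≡false (+-mono-≤-< (<⇒≤ (≰⇒> v≰u)) (≰⇒> v≰u))))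

  arcᵇ-chord : ∀ k i j → arcᵇ (suc (k + k)) i j ≡ chord k (toℕ i) (toℕ j)
  arcᵇ-chord k i j = cong (λ h → (1 ≤ᵇ δ) ∧ (δ ≤ᵇ h)) k+k/2
    where
    δ = diffMod (suc (k + k)) i j
    k+k/2 : (k + k) / 2 ≡ k
    k+k/2 = trans (cong (_/ 2) (trans (cong (k +_) (sym (+-identityʳ k))) (*-comm 2 k))) (m*n/n≡m k 2)

  cyclicSeqCount-double : ∀ m k →
    cyclicSeqCount (suc m) (suc (k + k)) ≡ fillSum (downFrom (suc (k + k))) (replicate (suc m) nothing) cycleIndicator
  cyclicSeqCount-double m k = Relabelling.cyclicSeqCount-fillSum (double k ∘ toℕ)
    (λ f → trans (∑-allFin (suc (k + k)) (f ∘ double k)) (∑-double k f))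
    (λ i j → ≡ᵇ-cong (cong (double k)) (double-injective (half k _ (toℕ<n i)) (half k _ (toℕ<n j))))
    (λ i j → trans (arcᵇ-chord k i j) (chord-double (half k _ (toℕ<n i)) (half k _ (toℕ<n j))))
    (suc m)

  -- Forward differences of the count and nilpotency of `N`.

  -- The effect of two more vertices on F n for odd n (F-+2).
  N : (State → ℕ) → State → ℕ
  N g st = ∑ (place true st) g + ∑[ s ← place false st ] (g s + ∑ (place true s) g)

  N-cong : ∀ {g h} → (∀ st → g st ≡ h st) → ∀ st → N g st ≡ N h st
  N-cong g≡h st = cong₂ _+_ (∑-cong g≡h (place true st))
    (∑-cong (λ s → cong₂ _+_ (g≡h s) (∑-cong g≡h (place true s))) (place false st))

  N-+ : ∀ g h st → N (λ s → g s + h s) st ≡ N g st + N h st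
  N-+ g h st = begin
    N (λ s → g s + h s) st
      ≡⟨ cong₂ _+_ (∑-+ g h (place true st))
           (∑-cong (λ s → trans (cong (g s + h s +_) (∑-+ g h (place true s))) (+-interchange (g s) (h s) _ _))
                   (place false st)) ⟩
    (∑ (place true st) g + ∑ (place true st) h)
      + ∑[ s ← place false st ] ((g s + ∑ (place true s) g) + (h s + ∑ (place true s) h))
      ≡⟨ cong (∑ (place true st) g + ∑ (place true st) h +_) (∑-+ _ _ (place false st)) ⟩
    (∑ (place true st) g + ∑ (place true st) h)
      + (∑[ s ← place false st ] (g s + ∑ (place true s) g) + ∑[ s ← place false st ] (h s + ∑ (place true s) h))
      ≡⟨ +-interchange (∑ (place true st) g) _ _ _ ⟩
    N g st + N h st ∎
    where open ≡-Reasoning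

  N^ : ℕ → (State → ℕ) → State → ℕ
  N^ zero    g = g
  N^ (suc j) g = N (N^ j g)

  N^-+ : ∀ j g h st → N^ j (λ s → g s + h s) st ≡ N^ j g st + N^ j h st
  N^-+ zero    g h st = refl
  N^-+ (suc j) g h st = trans (N-cong (N^-+ j g h) st) (N-+ (N^ j g) (N^ j h) st)

  N^-cong : ∀ j {g h} → (∀ st → g st ≡ h st) → ∀ st → N^ j g st ≡ N^ j h st
  N^-cong zero    g≡h = g≡h
  N^-cong (suc j) g≡h = N-cong (N^-cong j g≡h)

  N^-N : ∀ j g st → N^ j (N g) st ≡ N (N^ j g) st
  N^-N zero    g st = refl
  N^-N (suc j) g st = N-cong (N^-N j g) st

  -- The new vertices are `n`, odd, and `n + 1`, even. The terms of `N` stand for using `n` alone,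
  -- `n + 1` alone, or both with the larger placed first.
  F-+2 : ∀ {n} → odd n ≡ true → ∀ st → F (2 + n) st ≡ F n st + N (F n) st
  F-+2 {n} eq st rewrite eq = +-assoc (F n st) _ _

  -- The `j`-th forward difference at `k` of the number of completions of `st` in the tournament of
  -- order 2k+1.
  W : State → ℕ → ℕ → ℕ
  W st j k = N^ j (F (suc (k + k))) st

  W-suc : ∀ st j k → W st j (suc k) ≡ W st j k + W st (suc j) k
  W-suc st j k = begin
    N^ j (F (suc (suc k + suc k))) st          ≡⟨ cong (λ n → N^ j (F (2 + n)) st) (+-suc k k) ⟩
    N^ j (F (2 + n)) st                        ≡⟨ N^-cong j (F-+2 {n} (cong not (odd-double k))) st ⟩
    N^ j (λ s → F n s + N (F n) s) st          ≡⟨ N^-+ j (F n) (N (F n)) st ⟩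
    N^ j (F n) st + N^ j (N (F n)) st          ≡⟨ cong (N^ j (F n) st +_) (N^-N j (F n) st) ⟩
    N^ j (F n) st + N (N^ j (F n)) st          ∎
    where
    open ≡-Reasoning
    n = suc (k + k)

  holes : State → ℕ
  holes []             = 0
  holes (just _ ∷ st)  = holes st
  holes (nothing ∷ st) = suc (holes st)

  fits-holes : ∀ a p b st → All (λ s → holes s < suc (holes st)) (fits a p b st)
  fits-holes a p b st with enters a p ∧ leaves p b
  ... | true  = ≤-refl ∷ []
  ... | false = []

  placeBetween-holes : ∀ p e a st → All (λ s → holes s < holes st) (placeBetween p e a st)
  placeBetween-holes p e a []             = []
  placeBetween-holes p e a (just q ∷ st)  = All.map⁺ (placeBetween-holes p e (just q) st)
  placeBetween-holes p e a (nothing ∷ st) =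
    All.++⁺ (fits-holes a p (next e st) st) (All.map⁺ (All.map s≤s (placeBetween-holes p e nothing st)))

  place-holes : ∀ p st → All (λ s → holes s < holes st) (place p st)
  place-holes p []             = []
  place-holes p (just q ∷ st)  = All.map⁺ (placeBetween-holes p (just q) (just q) st)
  place-holes p (nothing ∷ []) = []
  place-holes p (nothing ∷ st@(_ ∷ _)) =
    All.++⁺ (fits-holes (last nothing st) p (next nothing st) st) (All.map⁺ (All.map s≤s (placeBetween-holes p nothing nothing st)))

  ∑-place-0 : ∀ p g st → (∀ s → holes s < holes st → g s ≡ 0) → ∑ (place p st) g ≡ 0
  ∑-place-0 p g st g≡0 = trans (∑-congᴬ (All.map (λ {s} → g≡0 s) (place-holes p st))) (∑-0 (place p st))

  -- N strictly decreases the number of empty slots, so it is nilpotent.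
  N^-0 : ∀ j g st → holes st < j → N^ j g st ≡ 0
  N^-0 (suc j) g st (s≤s holes≤j) = cong₂ _+_ (∑-place-0 true (N^ j g) st less)
    (∑-place-0 false _ st (λ s s<st → cong₂ _+_ (less s s<st)
      (∑-place-0 true (N^ j g) s (λ s′ s′<s → less s′ (<-trans s′<s s<st)))))
    where
    less : ∀ s → holes s < holes st → N^ j g s ≡ 0
    less s s<st = N^-0 j g s (<-≤-trans s<st holes≤j)

  -- Evaluation of the differences at k = 0.

  -- Memoising the values of a function on the states of at most m slots lets the iterates of N be evaluated by refl.
  data Trie : Set where
    leaf : ℕ → (State → ℕ) → Trie
    node : ℕ → Trie → Trie → Trie → Trie

  memo : ℕ → (State → ℕ) → Trie
  memo zero    f = leaf (f []) f
  memo (suc m) f = node (f []) (memo m (f ∘ (nothing ∷_))) (memo m (f ∘ (just false ∷_))) (memo m (f ∘ (just true ∷_)))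

  lookup : Trie → State → ℕ
  lookup (leaf v f)     []                = v
  lookup (leaf v f)     st@(_ ∷ _)        = f st
  lookup (node v a b c) []                = v
  lookup (node v a b c) (nothing ∷ st)    = lookup a st
  lookup (node v a b c) (just false ∷ st) = lookup b st
  lookup (node v a b c) (just true ∷ st)  = lookup c st

  -- A leaf keeps the function itself, so the equation holds for states of every length and no bound
  -- has to be carried along.
  lookup-memo : ∀ m f st → lookup (memo m f) st ≡ f st
  lookup-memo zero    f []                = refl
  lookup-memo zero    f (_ ∷ _)           = refl
  lookup-memo (suc m) f []                = refl
  lookup-memo (suc m) f (nothing ∷ st)    = lookup-memo m _ st
  lookup-memo (suc m) f (just false ∷ st) = lookup-memo m _ st
  lookup-memo (suc m) f (just true ∷ st)  = lookup-memo m _ st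

  -- u is an argument, not a let, so that the evaluator shares it.
  combine : ℕ → Trie → Trie → Trie
  combine m t u = memo m (λ st → lookup u st + ∑[ s ← place false st ] (lookup t s + lookup u s))

  -- The second table holds the sums over odd placements, which `N` needs at a state and at each of
  -- its even placements.
  nextTrie : ℕ → Trie → Trie
  nextTrie m t = combine m t (memo m (λ st → ∑ (place true st) (lookup t)))

  lookup-nextTrie : ∀ m t st → lookup (nextTrie m t) st ≡ N (lookup t) st
  lookup-nextTrie m t st = trans (lookup-memo m _ st) (cong₂ _+_ (lookup-memo m u st)
    (∑-cong (λ s → cong (lookup t s +_) (lookup-memo m u s)) (place false st)))
    where u = λ st → ∑ (place true st) (lookup t)

  tries : ℕ → ℕ → Trie
  tries m zero    = memo m (F 1)
  tries m (suc j) = nextTrie m (tries m j)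

  lookup-tries : ∀ m j st → lookup (tries m j) st ≡ N^ j (F 1) st
  lookup-tries m zero    st = lookup-memo m (F 1) st
  lookup-tries m (suc j) st = trans (lookup-nextTrie m (tries m j) st) (N-cong (lookup-tries m j) st)

  empty : State
  empty = replicate 8 nothing

  -- The default 0 encodes that all differences beyond the list vanish.
  nth : List ℕ → ℕ → ℕ
  nth []       i       = 0
  nth (c ∷ cs) zero    = c
  nth (c ∷ cs) (suc i) = nth cs i

  -- The forward differences at k = 0 of the number of 8-cycles of RLT_{2k+1}.
  coefficients : List ℕ
  coefficients = 0 ∷ 0 ∷ 0 ∷ 0 ∷ 441 ∷ 4439 ∷ 12654 ∷ 13968 ∷ 5312 ∷ []

  -- The factor 8 accounts for the choice of a starting vertex on each cycle.
  W-0 : ∀ j → W empty j 0 ≡ nth (map (8 *_) coefficients) j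
  W-0 j = trans (sym (lookup-tries 8 j empty)) (value j)
    where
    value : ∀ j → lookup (tries 8 j) empty ≡ nth (map (8 *_) coefficients) j
    value 0 = refl
    value 1 = refl
    value 2 = refl
    value 3 = refl
    value 4 = refl
    value 5 = refl
    value 6 = refl
    value 7 = refl
    value 8 = refl
    -- Nine iterations exceed the eight empty slots, so nilpotency applies.
    value j@(suc (suc (suc (suc (suc (suc (suc (suc (suc i))))))))) =
      trans (lookup-tries 8 j empty) (N^-0 j (F 1) empty (m≤m+n 9 i))

  -- Newton's forward difference formula.

  binomialSum : List ℕ → ℕ → ℕ → ℕ
  binomialSum []       k i = 0
  binomialSum (c ∷ cs) k i = c * (k C i) + binomialSum cs k (suc i)

  binomialSum-0 : ∀ cs i → binomialSum cs 0 (suc i) ≡ 0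
  binomialSum-0 []       i = refl
  binomialSum-0 (c ∷ cs) i = cong₂ _+_ (*-zeroʳ c) (binomialSum-0 cs (suc i))

  -- Pascal's rule, applied term by term.
  binomialSum-suc : ∀ cs k i → binomialSum cs (suc k) (suc i) ≡ binomialSum cs k i + binomialSum cs k (suc i)
  binomialSum-suc []       k i = refl
  binomialSum-suc (c ∷ cs) k i = trans
    (cong₂ _+_ (trans (cong (c *_) (sym (nCk+nC[k+1]≡[n+1]C[k+1] k i))) (*-distribˡ-+ c (k C i) _))
               (binomialSum-suc cs k (suc i)))
    (+-interchange (c * (k C i)) _ _ _)

  binomialSum-*ˡ : ∀ d cs k i → binomialSum (map (d *_) cs) k i ≡ d * binomialSum cs k i
  binomialSum-*ˡ d []       k i = sym (*-zeroʳ d)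
  binomialSum-*ˡ d (c ∷ cs) k i =
    trans (cong₂ _+_ (*-assoc d c _) (binomialSum-*ˡ d cs k (suc i))) (sym (*-distribˡ-+ d (c * (k C i)) _))

  module _ (t : ℕ → ℕ → ℕ) (t-suc : ∀ j k → t j (suc k) ≡ t j k + t (suc j) k) where

    -- Induction on `k` for all `j` at once: passing to the next difference drops the leading
    -- coefficient, and Pascal's rule recombines the two series.
    newton-forward : ∀ cs j k → (∀ i → t (i + j) 0 ≡ nth cs i) → t j k ≡ binomialSum cs k 0
    newton-forward []       j zero    eq = eq 0
    newton-forward (c ∷ cs) j zero    eq = begin
      t j 0                            ≡⟨ eq 0 ⟩
      c                                ≡⟨ *-identityʳ c ⟨
      c * 1                            ≡⟨ +-identityʳ (c * 1) ⟨
      c * 1 + 0                        ≡⟨ cong (c * 1 +_) (binomialSum-0 cs 0) ⟨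
      c * 1 + binomialSum cs 0 1       ∎
      where open ≡-Reasoning
    newton-forward []       j (suc k) eq = trans (t-suc j k) (cong₂ _+_ (newton-forward [] j k eq)
      (newton-forward [] (suc j) k (λ i → trans (cong (λ n → t n 0) (+-suc i j)) (eq (suc i)))))
    newton-forward (c ∷ cs) j (suc k) eq = begin
      t j (suc k)
        ≡⟨ t-suc j k ⟩
      t j k + t (suc j) k
        ≡⟨ cong₂ _+_ (newton-forward (c ∷ cs) j k eq)
             (newton-forward cs (suc j) k (λ i → trans (cong (λ n → t n 0) (+-suc i j)) (eq (suc i)))) ⟩
      c * 1 + binomialSum cs k 1 + binomialSum cs k 0
        ≡⟨ +-assoc (c * 1) _ _ ⟩
      c * 1 + (binomialSum cs k 1 + binomialSum cs k 0)
        ≡⟨ cong (c * 1 +_) (trans (binomialSum-suc cs k 0) (+-comm (binomialSum cs k 0) _)) ⟨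
      c * 1 + binomialSum cs (suc k) 1 ∎
      where open ≡-Reasoning

  cyclicSeqCount-8 : ∀ k → cyclicSeqCount 8 (suc (k + k)) ≡ 8 * binomialSum coefficients k 0
  cyclicSeqCount-8 k = begin
    cyclicSeqCount 8 n                                        ≡⟨ cyclicSeqCount-double 7 k ⟩
    fillSum (downFrom n) (replicate 8 nothing) cycleIndicator         ≡⟨ fillSum-F n (replicate 8 nothing) [] [] ⟩
    -- No slot is filled, so `closed` holds and its indicator computes to `1`.
    1 * F n empty                                             ≡⟨ *-identityˡ (F n empty) ⟩
    W empty 0 k                                               ≡⟨ newton-forward (W empty) (W-suc empty) (map (8 *_) coefficients) 0 k
                                                                   (λ i → trans (cong (λ j → W empty j 0) (+-identityʳ i)) (W-0 i)) ⟩
    binomialSum (map (8 *_) coefficients) k 0                 ≡⟨ binomialSum-*ˡ 8 coefficients k 0 ⟩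
    8 * binomialSum coefficients k 0                          ∎
    where
    open ≡-Reasoning
    n = suc (k + k)

  cRLT-8 : ∀ k → cRLT 8 (suc (k + k)) ≡ binomialSum coefficients k 0
  cRLT-8 k = trans (cong (_/ 8) (trans (cyclicSeqCount-8 k) (*-comm 8 q))) (m*n/n≡m q 8)
    where q = binomialSum coefficients k 0

open Counting using (binomialSum; cRLT-8)
open import Data.Integer using (ℤ; +_; _+_; _-_; _*_)
open import Data.Integer.Properties using (pos-*; *-zeroʳ)
open import Data.Integer.Tactic.RingSolver using (solve-∀)
open import Data.Nat as ℕ using (zero; suc; _!)
import Data.Nat.Properties as ℕ
open ≡-Reasoning

-- Falling factorials and the closed form over the integers.

falling : ℤ → ℕ → ℤ
falling x zero    = + 1
falling x (suc i) = falling x i * (x - + i)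

falling-0 : ∀ i → falling (+ 0) (suc i) ≡ + 0
falling-0 zero    = refl
falling-0 (suc i) = cong (_* (+ 0 - + suc i)) (falling-0 i)

-- The power rule for finite differences of falling factorials; it plays against Pascal's rule in
-- `!*C≡falling`.
falling-suc : ∀ x i → falling (+ 1 + x) (suc i) ≡ + suc i * falling x i + falling x (suc i)
falling-suc x zero    = base x
  where
  base : ∀ x → + 1 * (+ 1 + x - + 0) ≡ + 1 * + 1 + + 1 * (x - + 0)
  base = solve-∀
falling-suc x (suc i) = begin
  falling (+ 1 + x) (suc i) * (+ 1 + x - (+ 1 + + i))
    ≡⟨ cong (_* (+ 1 + x - (+ 1 + + i))) (falling-suc x i) ⟩
  ((+ 1 + + i) * f + f * (x - + i)) * (+ 1 + x - (+ 1 + + i))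
    ≡⟨ step x (+ i) f ⟩
  (+ 1 + (+ 1 + + i)) * (f * (x - + i)) + f * (x - + i) * (x - (+ 1 + + i)) ∎
  where
  f = falling x i
  step : ∀ x i f → ((+ 1 + i) * f + f * (x - i)) * (+ 1 + x - (+ 1 + i))
       ≡ (+ 1 + (+ 1 + i)) * (f * (x - i)) + f * (x - i) * (x - (+ 1 + i))
  step = solve-∀

!*C≡falling : ∀ k i → + (i !) * + (k C i) ≡ falling (+ k) i
!*C≡falling k       zero    = refl
!*C≡falling zero    (suc i) = trans (*-zeroʳ (+ (suc i !))) (sym (falling-0 i))
!*C≡falling (suc k) (suc i) = begin
  + (suc i !) * + (suc k C suc i)
    ≡⟨ cong₂ _*_ (pos-* (suc i) (i !)) (cong +_ (sym (nCk+nC[k+1]≡[n+1]C[k+1] k i))) ⟩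
  + suc i * + (i !) * (+ (k C i) + + (k C suc i))
    ≡⟨ expand (+ suc i) (+ (i !)) (+ (k C i)) (+ (k C suc i)) ⟩
  + suc i * (+ (i !) * + (k C i)) + + suc i * + (i !) * + (k C suc i)
    ≡⟨ cong (λ z → + suc i * (+ (i !) * + (k C i)) + z * + (k C suc i)) (pos-* (suc i) (i !)) ⟨
  + suc i * (+ (i !) * + (k C i)) + + (suc i !) * + (k C suc i)
    ≡⟨ cong₂ (λ a b → + suc i * a + b) (!*C≡falling k i) (!*C≡falling k (suc i)) ⟩
  + suc i * falling (+ k) i + falling (+ k) (suc i)
    ≡⟨ falling-suc (+ k) i ⟨
  falling (+ suc k) (suc i) ∎
  where
  expand : ∀ s f a b → s * f * (a + b) ≡ s * (f * a) + s * f * b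
  expand = solve-∀

-- `D` serves as a common multiple of the factorials and `w` as the cofactor of `i !`, so the
-- leading binomial is cleared of its denominator.
binomialSum-falling : ∀ {D w} c cs k i → D ≡ w * + (i !) →
  D * + binomialSum (c ∷ cs) k i ≡ + c * w * falling (+ k) i + D * + binomialSum cs k (suc i)
binomialSum-falling {w = w} c cs k i refl = begin
  w * + (i !) * + (c ℕ.* (k C i) ℕ.+ r)
    ≡⟨ cong (λ z → w * + (i !) * (z + + r)) (pos-* c (k C i)) ⟩
  w * + (i !) * (+ c * + (k C i) + + r)
    ≡⟨ expand w (+ (i !)) (+ c) (+ (k C i)) (+ r) ⟩
  + c * w * (+ (i !) * + (k C i)) + w * + (i !) * + r
    ≡⟨ cong (λ z → + c * w * z + w * + (i !) * + r) (!*C≡falling k i) ⟩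
  + c * w * falling (+ k) i + w * + (i !) * + r ∎
  where
  r = binomialSum cs k (suc i)
  expand : ∀ w d c b r → w * d * (c * b + r) ≡ c * w * (d * b) + w * d * r
  expand = solve-∀

-- The literals are kept out of this lemma, as Agda would unfold a product by a large literal in unary.
binomialSum-horner : ∀ {D w₄ w₅ w₆ w₇ w₈} c₄ c₅ c₆ c₇ c₈ k → let x = + k in
  D ≡ w₄ * + (4 !) → D ≡ w₅ * + (5 !) → D ≡ w₆ * + (6 !) → D ≡ w₇ * + (7 !) → D ≡ w₈ * + (8 !) →
  D * + binomialSum (c₄ ∷ c₅ ∷ c₆ ∷ c₇ ∷ c₈ ∷ []) k 4 ≡
  falling x 4 * (+ c₄ * w₄ + (x - + 4) * (+ c₅ * w₅ + (x - + 5) * (+ c₆ * w₆ + (x - + 6) * (+ c₇ * w₇ + (x - + 7) * (+ c₈ * w₈)))))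
binomialSum-horner {D} {w₄} {w₅} {w₆} {w₇} {w₈} c₄ c₅ c₆ c₇ c₈ k eq₄ eq₅ eq₆ eq₇ eq₈ = begin
  D * + binomialSum (c₄ ∷ c₅ ∷ c₆ ∷ c₇ ∷ c₈ ∷ []) k 4
    ≡⟨ unfold c₄ (c₅ ∷ c₆ ∷ c₇ ∷ c₈ ∷ []) 4 eq₄
      (unfold c₅ (c₆ ∷ c₇ ∷ c₈ ∷ []) 5 eq₅
      (unfold c₆ (c₇ ∷ c₈ ∷ []) 6 eq₆
      (unfold c₇ (c₈ ∷ []) 7 eq₇
      (unfold c₈ [] 8 eq₈ (*-zeroʳ D))))) ⟩
  + c₄ * w₄ * f + (+ c₅ * w₅ * (f * (x - + 4)) + (+ c₆ * w₆ * (f * (x - + 4) * (x - + 5))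
    + (+ c₇ * w₇ * (f * (x - + 4) * (x - + 5) * (x - + 6))
    + (+ c₈ * w₈ * (f * (x - + 4) * (x - + 5) * (x - + 6) * (x - + 7)) + + 0))))
    ≡⟨ horner (+ c₄ * w₄) (+ c₅ * w₅) (+ c₆ * w₆) (+ c₇ * w₇) (+ c₈ * w₈) f (x - + 4) (x - + 5) (x - + 6) (x - + 7) ⟩
  f * (+ c₄ * w₄ + (x - + 4) * (+ c₅ * w₅ + (x - + 5) * (+ c₆ * w₆ + (x - + 6) * (+ c₇ * w₇ + (x - + 7) * (+ c₈ * w₈))))) ∎
  where
  x = + k
  f = falling x 4

  unfold : ∀ {w r} c cs i → D ≡ w * + (i !) → D * + binomialSum cs k (suc i) ≡ r →
    D * + binomialSum (c ∷ cs) k i ≡ + c * w * falling x i + r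
  unfold {w} c cs i eq rest =
    trans (binomialSum-falling c cs k i eq) (cong (λ z → + c * w * falling x i + z) rest)

  horner : ∀ c₄ c₅ c₆ c₇ c₈ f x₄ x₅ x₆ x₇ →
    c₄ * f + (c₅ * (f * x₄) + (c₆ * (f * x₄ * x₅)
      + (c₇ * (f * x₄ * x₅ * x₆) + (c₈ * (f * x₄ * x₅ * x₆ * x₇) + + 0))))
    ≡ f * (c₄ + x₄ * (c₅ + x₅ * (c₆ + x₆ * (c₇ + x₇ * c₈))))
  horner = solve-∀

-- With n = 2x+1 each factor n - (2i+1) equals 2(x - i), whence 16 = 2^4.
falling-4 : ∀ x → (+ 2 * x + + 1 - + 1) * (+ 2 * x + + 1 - + 3) * (+ 2 * x + + 1 - + 5) * (+ 2 * x + + 1 - + 7)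
                ≡ + 16 * falling x 4
falling-4 = expanded
  where
  -- The ring solver is given `falling x 4` in unfolded form.
  expanded : ∀ x → (+ 2 * x + + 1 - + 1) * (+ 2 * x + + 1 - + 3) * (+ 2 * x + + 1 - + 5) * (+ 2 * x + + 1 - + 7)
                 ≡ + 16 * (+ 1 * (x - + 0) * (x - + 1) * (x - + 2) * (x - + 3))
  expanded = solve-∀

-- What remains after `falling x 4` is split off. The constants 6720, 1344, 224, 32 and 4 are 161280
-- / i! for i from 4 to 8.
quartic : ∀ x →
  + 441 * + 6720 + (x - + 4) * (+ 4439 * + 1344 + (x - + 5) * (+ 12654 * + 224 + (x - + 6) * (+ 13968 * + 32 + (x - + 7) * (+ 5312 * + 4))))
  ≡ (+ 2 * x + + 1 + + 1) * (+ 2 * x + + 1) * + 16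
      * (+ 83 * (+ 2 * x + + 1) * (+ 2 * x + + 1) - + 575 * (+ 2 * x + + 1) + + 510)
quartic = solve-∀

-- Treating `falling x 4` as one symbol leaves only identities of degree four in `x` to be expanded.
factorisation : ∀ x → let n = + 2 * x + + 1 in
  falling x 4 * (+ 441 * + 6720 + (x - + 4) * (+ 4439 * + 1344 + (x - + 5) * (+ 12654 * + 224 + (x - + 6) * (+ 13968 * + 32 + (x - + 7) * (+ 5312 * + 4)))))
  ≡ (n + + 1) * n * (n - + 1) * (n - + 3) * (n - + 5) * (n - + 7) * (+ 83 * n * n - + 575 * n + + 510)
factorisation x = trans (cong (falling x 4 *_) (quartic x))
  (regroup (falling x 4) (n + + 1) n (+ 16) (+ 83 * n * n - + 575 * n + + 510) (n - + 1) (n - + 3) (n - + 5) (n - + 7) (falling-4 x))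
  where
  n = + 2 * x + + 1

  regroup : ∀ f a b s q c d e g → c * d * e * g ≡ s * f →
    f * (a * b * s * q) ≡ a * b * c * d * e * g * q
  regroup f a b s q c d e g eq = begin
    f * (a * b * s * q)              ≡⟨ inward f a b s q ⟩
    a * b * (s * f) * q              ≡⟨ cong (λ z → a * b * z * q) eq ⟨
    a * b * (c * d * e * g) * q      ≡⟨ flatten a b c d e g q ⟩
    a * b * c * d * e * g * q        ∎
    where
    inward : ∀ f a b s q → f * (a * b * s * q) ≡ a * b * (s * f) * q
    inward = solve-∀
    flatten : ∀ a b c d e g q → a * b * (c * d * e * g) * q ≡ a * b * c * d * e * g * q
    flatten = solve-∀

theorem2 : (k : ℕ) →
    let n = + (2 Data.Nat.* k Data.Nat.+ 1) in
    + 161280 * + cRLT 8 (2 Data.Nat.* k Data.Nat.+ 1) ≡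
    (n + + 1) * n * (n - + 1) * (n - + 3) * (n - + 5) * (n - + 7)
    * (+ 83 * n * n - + 575 * n + + 510)
theorem2 k =
  trans (cong (λ c → + 161280 * + c) count)
  -- Each `refl` checks 161280 = w * i! for one i from 4 to 8.
  (trans (binomialSum-horner {w₄ = + 6720} {+ 1344} {+ 224} {+ 32} {+ 4} 441 4439 12654 13968 5312 k refl refl refl refl refl)
  (trans (factorisation (+ k))
  (cong (λ n → (n + + 1) * n * (n - + 1) * (n - + 3) * (n - + 5) * (n - + 7) * (+ 83 * n * n - + 575 * n + + 510))
        (cong (_+ + 1) (sym (pos-* 2 k))))))
  where
  2k+1 : 2 ℕ.* k ℕ.+ 1 ≡ suc (k ℕ.+ k)
  2k+1 = trans (ℕ.+-comm (2 ℕ.* k) 1) (cong (λ z → suc (k ℕ.+ z)) (ℕ.+-identityʳ k))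

  -- The four leading coefficients are 0 (fewer than eight vertices for k < 4), so their terms
  -- compute away and the series starts at index 4.
  count : cRLT 8 (2 ℕ.* k ℕ.+ 1) ≡ binomialSum (441 ∷ 4439 ∷ 12654 ∷ 13968 ∷ 5312 ∷ []) k 4
  count = trans (cong (cRLT 8) 2k+1) (cRLT-8 k)
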